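{- For every $K_3N$ $n=pqr$: (a) $C\le\mathcal C(H)$; (b) $BC\le\mathcal B(H)\,\mathcal C(H)$; (c) $ABC\le\mathcal A(H)\,\mathcal B(H)\,\mathcal C(H)$; (d) $n\le\mathcal N(H)$; with equality (in each case) if and only if $E=2$ and $F=G=1$. If there is equality then $H\not\equiv 2\pmod 6$, and if also $n$ is a $C_3N$, then $H\equiv 0\pmod 6$.
   Context: A $K_3N$ (Korselt number with three factors) is an integer $n$ together with a factorisation $n=pqr$, where $1<p<q<r$ are odd integers (not necessarily prime) such that each of $p-1,\ q-1,\ r-1$ divides $n-1$, and such that $E:=\dfrac{pq-1}{r-1}$ (which is an integer by the divisibility condition) satisfies $E\ge 2$. A $C_3N$ is a Carmichael number with exactly three prime factors $p<q<r$, i.e. a $K_3N$ $n=pqr$ in which $p,q,r$ are all prime. Put $H:=\gcd(p-1,q-1,r-1)$, $A:=\frac{p-1}{H}$, $B:=\frac{q-1}{H}$, $C:=\frac{r-1}{H}$, $F:=H\left(\frac1A+\frac1B+\frac1C\right)+\frac1{AB}+\frac1{AC}+\frac1{BC}$ (which is a positive integer), and $G:=AF-H$. The following polynomials are used: $\mathcal A(x):=x+1$, $\mathcal B(x):=x^2+x+3$, $\mathcal C(x):=\frac12\left(x^4+2x^3+5x^2+5x+4\right)$, and $$\mathcal N(x):=\tfrac12\left(x^{10}+4x^9+14x^8+30x^7+53x^6+69x^5+71x^4+55x^3+31x^2+12x+2\right).$$ -}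

module Defs where

open import Data.Integer.Base as ℤ using (+_; 1ℤ)
open import Data.Nat.Base as ℕ using (ℕ; NonZero; _∸_; _<_; _≤_; _^_)
open import Data.Nat.Divisibility using (_∣_; ∣-trans; ∣⇒≤; ∣m+n∣m⇒∣n; n∣m*n)
open import Data.Nat.DivMod using (m/n*n≡m; m≥n⇒m/n>0)
open import Data.Nat.GCD using (gcd; gcd[m,n]∣m; gcd[m,n]∣n; gcd[m,n]≢0)
open import Data.Nat.Primality using (Prime)
open import Data.Nat.Properties as ℕₚ using (<-trans; m*n≢0; m<n⇒0<n∸m)
open import Data.Product.Base using (_×_)
open import Data.Rational.Base as ℚ using (ℚ; ½)
open import Data.Sum.Base using (inj₁)
open import Relation.Binary.PropositionalEquality
open import Relation.Nullary.Negation using (¬_)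

ι : ℕ → ℚ
ι n = + n ℚ./ 1

𝒜 ℬ 𝒞 𝒩 : ℕ → ℚ
𝒜 x = ι (x ℕ.+ 1)
ℬ x = ι (x ^ 2 ℕ.+ x ℕ.+ 3)
𝒞 x = ½ ℚ.* ι (x ^ 4 ℕ.+ 2 ℕ.* x ^ 3 ℕ.+ 5 ℕ.* x ^ 2 ℕ.+ 5 ℕ.* x ℕ.+ 4)
𝒩 x = ½ ℚ.* ι (x ^ 10 ℕ.+ 4 ℕ.* x ^ 9 ℕ.+ 14 ℕ.* x ^ 8 ℕ.+ 30 ℕ.* x ^ 7
              ℕ.+ 53 ℕ.* x ^ 6 ℕ.+ 69 ℕ.* x ^ 5 ℕ.+ 71 ℕ.* x ^ 4
              ℕ.+ 55 ℕ.* x ^ 3 ℕ.+ 31 ℕ.* x ^ 2 ℕ.+ 12 ℕ.* x ℕ.+ 2)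

record K₃N : Set where
  field
    p q r : ℕ
    1<p   : 1 < p
    p<q   : p < q
    q<r   : q < r
    p-odd : ¬ (2 ∣ p)
    q-odd : ¬ (2 ∣ q)
    r-odd : ¬ (2 ∣ r)

  n : ℕ
  n = p ℕ.* q ℕ.* r

  -- p, q, r and n all exceed 1, so every truncated subtraction ∸ 1 in this
  -- record is a true subtraction.
  field
    p-1∣n-1 : p ∸ 1 ∣ n ∸ 1
    q-1∣n-1 : q ∸ 1 ∣ n ∸ 1
    r-1∣n-1 : r ∸ 1 ∣ n ∸ 1

  1<q : 1 < q
  1<q = <-trans 1<p p<q

  1<r : 1 < r
  1<r = <-trans 1<q q<r

  instance
    p-1≢0 : NonZero (p ∸ 1)
    p-1≢0 = ℕ.>-nonZero (m<n⇒0<n∸m 1<p)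

    q-1≢0 : NonZero (q ∸ 1)
    q-1≢0 = ℕ.>-nonZero (m<n⇒0<n∸m 1<q)

    r-1≢0 : NonZero (r ∸ 1)
    r-1≢0 = ℕ.>-nonZero (m<n⇒0<n∸m 1<r)

  -- The ℕ-divisions defining E, A, B and C are exact: see E-exact, A-exact,
  -- B-exact and C-exact.
  E : ℕ
  E = (p ℕ.* q ∸ 1) ℕ./ (r ∸ 1)

  field
    2≤E : 2 ≤ E

  E-exact : E ℕ.* (r ∸ 1) ≡ p ℕ.* q ∸ 1
  E-exact = m/n*n≡m r-1∣pq-1
    where
    n-1-split : ∀ a b → 1 < b → 1 ≤ a →
                a ℕ.* b ∸ 1 ≡ a ℕ.* (b ∸ 1) ℕ.+ (a ∸ 1)
    n-1-split (ℕ.suc a) (ℕ.suc b) _ _ = begin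
      b ℕ.+ a ℕ.* ℕ.suc b       ≡⟨ cong (b ℕ.+_) (ℕₚ.*-suc a b) ⟩
      b ℕ.+ (a ℕ.+ a ℕ.* b)     ≡⟨ cong (b ℕ.+_) (ℕₚ.+-comm a (a ℕ.* b)) ⟩
      b ℕ.+ (a ℕ.* b ℕ.+ a)     ≡⟨ ℕₚ.+-assoc b (a ℕ.* b) a ⟨
      b ℕ.+ a ℕ.* b ℕ.+ a       ∎
      where open ≡-Reasoning

    r-1∣pq-1 : r ∸ 1 ∣ p ℕ.* q ∸ 1
    r-1∣pq-1 = ∣m+n∣m⇒∣n
      (subst (r ∸ 1 ∣_)
        (n-1-split (p ℕ.* q) r 1<r (ℕₚ.*-mono-≤ (ℕₚ.<⇒≤ 1<p) (ℕₚ.<⇒≤ 1<q)))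
        r-1∣n-1)
      (n∣m*n (p ℕ.* q))

  H : ℕ
  H = gcd (p ∸ 1) (gcd (q ∸ 1) (r ∸ 1))

  H∣p-1 : H ∣ p ∸ 1
  H∣p-1 = gcd[m,n]∣m _ _

  H∣q-1 : H ∣ q ∸ 1
  H∣q-1 = ∣-trans (gcd[m,n]∣n (p ∸ 1) _) (gcd[m,n]∣m _ _)

  H∣r-1 : H ∣ r ∸ 1
  H∣r-1 = ∣-trans (gcd[m,n]∣n (p ∸ 1) _) (gcd[m,n]∣n (q ∸ 1) _)

  instance
    H≢0 : NonZero H
    H≢0 = ℕ.≢-nonZero (gcd[m,n]≢0 (p ∸ 1) _ (inj₁ (ℕ.≢-nonZero⁻¹ (p ∸ 1))))

  A B C : ℕ
  A = (p ∸ 1) ℕ./ H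
  B = (q ∸ 1) ℕ./ H
  C = (r ∸ 1) ℕ./ H

  A-exact : A ℕ.* H ≡ p ∸ 1
  A-exact = m/n*n≡m H∣p-1

  B-exact : B ℕ.* H ≡ q ∸ 1
  B-exact = m/n*n≡m H∣q-1

  C-exact : C ℕ.* H ≡ r ∸ 1
  C-exact = m/n*n≡m H∣r-1

  instance
    A≢0 : NonZero A
    A≢0 = ℕ.>-nonZero (m≥n⇒m/n>0 (∣⇒≤ H∣p-1))

    B≢0 : NonZero B
    B≢0 = ℕ.>-nonZero (m≥n⇒m/n>0 (∣⇒≤ H∣q-1))

    C≢0 : NonZero C
    C≢0 = ℕ.>-nonZero (m≥n⇒m/n>0 (∣⇒≤ H∣r-1))

    AB≢0 : NonZero (A ℕ.* B)
    AB≢0 = m*n≢0 A B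

    AC≢0 : NonZero (A ℕ.* C)
    AC≢0 = m*n≢0 A C

    BC≢0 : NonZero (B ℕ.* C)
    BC≢0 = m*n≢0 B C

  F : ℚ
  F = ι H ℚ.* (1ℤ ℚ./ A ℚ.+ 1ℤ ℚ./ B ℚ.+ 1ℤ ℚ./ C)
      ℚ.+ 1ℤ ℚ./ (A ℕ.* B) ℚ.+ 1ℤ ℚ./ (A ℕ.* C) ℚ.+ 1ℤ ℚ./ (B ℕ.* C)

  G : ℚ
  G = ι A ℚ.* F ℚ.- ι H

-- p, q, r are the only factors > 1 that a product of three primes can have in a
-- factorisation into three such factors, so no other factorisation is relevant.
IsC₃N : K₃N → Set
IsC₃N κ = Prime p × Prime q × Prime r
  where open K₃N κ

{-# OPTIONS --safe #-}
-- Put L = AH + 1. The divisibility conditions imply that A, B, C are pairwise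
-- coprime and that
--   F A = G + H,   G B = E + L,   E C = L B + A
-- with positive integers F and G, so that E, F, G and H determine n. From
-- A < B < C one gets E < L and G < 2H. The quantities C, BC, ABC and n, at fixed
-- G, are largest for E = 2 and F = 1. The values at E = 2, F = 1 are bounded by
-- functions convex in G which agree at G = 1 and G = H² + 3, so that the maximum
-- is at G = 1. There A = H + 1 and B = H² + H + 3, which have the common
-- divisor 3 if H ≡ 2 (mod 3), and p = H² + H + 1 is divisible by 3 if
-- H ≡ 1 (mod 3).
module Submission where

open import Defs
open import Data.List.Base using ([]; _∷_)
open import Data.Nat.Base as ℕ using (ℕ; zero; suc; z≤n; s≤s; NonZero; _∸_)
open import Data.Nat.Coprimality using (Coprime; coprime-divisor)
open import Data.Nat.Divisibility
open import Data.Nat.DivMod using (m≡m%n+[m/n]*n; m%n<n)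
open import Data.Nat.GCD using (gcd-greatest)
open import Data.Nat.Primality using (Prime; prime⇒irreducible)
import Data.Nat.Properties as ℕₚ
open import Data.Nat.Tactic.RingSolver using () renaming (solve to ring)
open import Data.Product.Base using (_×_; _,_)
open import Data.Sum.Base using (_⊎_; inj₁; inj₂; [_,_])
open import Function.Bundles using (_⇔_; mk⇔; Equivalence)
open import Function.Construct.Composition using (_⇔-∘_)
open import Relation.Binary.PropositionalEquality hiding ([_])
open import Relation.Nullary.Decidable using (from-no)
open import Relation.Nullary.Negation using (¬_; contradiction)

-- Coprimality of A, B, C and the integers F and G.

module NaturalNumbers where
  open import Data.Nat.Base
  open import Data.Nat.Properties
  open import Data.Nat.Solver using (module +-*-Solver)

  -- With p = ah + 1, q = bh + 1, r = ch + 1, n - 1 = ah · qr + (qr - 1) and qr - 1 = (bch + b + c)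
  -- h. The first summand is a multiple of ah, and h cancels.
  factor∣ : ∀ a b c h .{{_ : NonZero h}} →
            a * h ∣ suc (a * h) * suc (b * h) * suc (c * h) ∸ 1 → a ∣ b * c * h + b + c
  factor∣ a b c h ah∣ = *-cancelʳ-∣ h (∣m+n∣m⇒∣n (subst (a * h ∣_) split ah∣)
    (m∣m*n (suc (b * h) * suc (c * h))))
    where
    expand : suc (a * h) * suc (b * h) * suc (c * h) ≡
             suc (a * h * (suc (b * h) * suc (c * h)) + (b * c * h + b + c) * h)
    expand = ring (a ∷ b ∷ c ∷ h ∷ [])

    split : suc (a * h) * suc (b * h) * suc (c * h) ∸ 1 ≡
            a * h * (suc (b * h) * suc (c * h)) + (b * c * h + b + c) * h
    split = cong (_∸ 1) expand

  TripleCoprime : ℕ → ℕ → ℕ → Set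
  TripleCoprime a b c = ∀ {d} → d ∣ a → d ∣ b → d ∣ c → d ≡ 1

  -- A common divisor of a and b divides a (ch + 1) + c, hence also c.
  pairwise-coprime : ∀ a b c h → TripleCoprime a b c → b ∣ a * c * h + a + c → Coprime a b
  pairwise-coprime a b c h coprime b∣ {d} (d∣a , d∣b) = coprime d∣a d∣b
    (∣m+n∣m⇒∣n (subst (d ∣_) regroup (∣-trans d∣b b∣)) (∣m⇒∣m*n (c * h + 1) d∣a))
    where
    regroup : a * c * h + a + c ≡ a * (c * h + 1) + c
    regroup = ring (a ∷ c ∷ h ∷ [])

  coprime-*ˡ : ∀ {a b c} → Coprime a c → Coprime b c → Coprime (a * b) c
  coprime-*ˡ a⊥c b⊥c (d∣ab , d∣c) = b⊥c
    (coprime-divisor (λ { (k∣d , k∣a) → a⊥c (k∣a , ∣-trans k∣d d∣c) }) d∣ab , d∣c)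

  coprime-*-∣ : ∀ {m n x} → Coprime m n → m ∣ x → n ∣ x → m * n ∣ x
  coprime-*-∣ {m} {n} m⊥n (divides-refl q) n∣qm with
    coprime-divisor (λ { (k∣n , k∣m) → m⊥n (k∣m , k∣n) }) (subst (n ∣_) (*-comm q m) n∣qm)
  ... | divides-refl k = divides k (trans (*-assoc k n m) (cong (k *_) (*-comm n m)))

  module Quotients (a b c h E : ℕ) .{{_ : NonZero b}} .{{_ : NonZero c}}
    (coprime : TripleCoprime a b c)
    (a∣ : a ∣ b * c * h + b + c) (b∣ : b ∣ a * c * h + a + c) (c∣ : c ∣ a * b * h + a + b)
    (Ec : E * c ≡ suc (h * a) * b + a)
    where

    -- The numerator of F over the common denominator abc.
    N : ℕ
    N = h * (b * c + a * c + a * b) + c + b + a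

    a⊥b : Coprime a b
    a⊥b = pairwise-coprime a b c h coprime b∣

    a⊥c : Coprime a c
    a⊥c = pairwise-coprime a c b h (λ d∣a d∣c d∣b → coprime d∣a d∣b d∣c) c∣

    b⊥c : Coprime b c
    b⊥c = pairwise-coprime b c a h (λ d∣b d∣c d∣a → coprime d∣a d∣b d∣c)
      (subst (c ∣_) swap c∣)
      where
      swap : a * b * h + a + b ≡ b * a * h + b + a
      swap = ring (a ∷ b ∷ h ∷ [])

    -- Modulo each of a, b, c, `N` reduces to the expression which that number divides by
    -- hypothesis; pairwise coprimality combines the three divisibilities.
    abc∣N : a * b * c ∣ N
    abc∣N = coprime-*-∣ (coprime-*ˡ a⊥c b⊥c) (coprime-*-∣ a⊥b a∣N b∣N) c∣N
      where
      a-part : b * c * h + b + c + a * (h * c + h * b + 1) ≡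
               h * (b * c + a * c + a * b) + c + b + a
      a-part = ring (a ∷ b ∷ c ∷ h ∷ [])

      b-part : a * c * h + a + c + b * (h * c + h * a + 1) ≡
               h * (b * c + a * c + a * b) + c + b + a
      b-part = ring (a ∷ b ∷ c ∷ h ∷ [])

      c-part : a * b * h + a + b + c * (h * a + h * b + 1) ≡
               h * (b * c + a * c + a * b) + c + b + a
      c-part = ring (a ∷ b ∷ c ∷ h ∷ [])

      a∣N : a ∣ N
      a∣N = subst (a ∣_) a-part (∣m∣n⇒∣m+n a∣ (m∣m*n (h * c + h * b + 1)))

      b∣N : b ∣ N
      b∣N = subst (b ∣_) b-part (∣m∣n⇒∣m+n b∣ (m∣m*n (h * c + h * a + 1)))

      c∣N : c ∣ N
      c∣N = subst (c ∣_) c-part (∣m∣n⇒∣m+n c∣ (m∣m*n (h * a + h * b + 1)))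

    -- Unfolding f and g would make the comparisons of rationals below very slow.
    abstract
      f : ℕ
      f = quotient abc∣N

      fabc : f * (a * b * c) ≡ N
      fabc = sym (_∣_.equality abc∣N)

    -- Since `N` is c (hb + ha + 1) plus Lb + a, with L = ha + 1, and Lb + a = Ec, a factor c
    -- cancels from f · abc = `N`.
    bfa : b * (f * a) ≡ b * h + (E + suc (h * a))
    bfa = *-cancelʳ-≡ _ _ c (begin
      b * (f * a) * c                              ≡⟨ lhs f ⟩
      f * (a * b * c)                              ≡⟨ fabc ⟩
      h * (b * c + a * c + a * b) + c + b + a      ≡⟨ ring (a ∷ b ∷ c ∷ h ∷ []) ⟩
      c * (h * b + h * a + 1) + (suc (h * a) * b + a)
                                                   ≡⟨ cong (c * (h * b + h * a + 1) +_) Ec ⟨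
      c * (h * b + h * a + 1) + E * c              ≡⟨ ring (a ∷ b ∷ c ∷ h ∷ E ∷ []) ⟩
      (b * h + (E + suc (h * a))) * c              ∎)
      where
      open ≡-Reasoning
      lhs : ∀ f → b * (f * a) * c ≡ f * (a * b * c)
      lhs f = ring (a ∷ b ∷ c ∷ f ∷ [])

    abstract
      g : ℕ
      g = f * a ∸ h

      -- The subtraction in `g` is exact: by `bfa`, bh ≤ b (fa), and b cancels.
      fa : f * a ≡ g + h
      fa = sym (m∸n+n≡m (*-cancelˡ-≤ b (m+n≤o⇒m≤o (b * h) (≤-reflexive (sym bfa)))))

      gb : g * b ≡ E + suc (h * a)
      gb = +-cancelˡ-≡ (b * h) _ _ (begin
        b * h + g * b             ≡⟨ regroup g ⟩
        b * (g + h)               ≡⟨ cong (b *_) fa ⟨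
        b * (f * a)               ≡⟨ bfa ⟩
        b * h + (E + suc (h * a)) ∎)
        where
        open ≡-Reasoning
        regroup : ∀ g → b * h + g * b ≡ b * (g + h)
        regroup g = ring (b ∷ h ∷ g ∷ [])

  -- The bounding polynomials, doubled where their coefficients are not integral.

  ℬₙ 2𝒞 2𝒩 : ℕ → ℕ
  ℬₙ x = x ^ 2 + x + 3
  2𝒞 x = x ^ 4 + 2 * x ^ 3 + 5 * x ^ 2 + 5 * x + 4
  2𝒩 x = x ^ 10 + 4 * x ^ 9 + 14 * x ^ 8 + 30 * x ^ 7 + 53 * x ^ 6 + 69 * x ^ 5 + 71 * x ^ 4
         + 55 * x ^ 3 + 31 * x ^ 2 + 12 * x + 2

  private
    open +-*-Solver

    infixr 9 _∧_
    _∧_ : ∀ {k} → Polynomial k → ℕ → Polynomial k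
    x ∧ zero  = con 1
    x ∧ suc n = x :* (x ∧ n)

    ℬ-poly 2𝒞-poly : ∀ {k} → Polynomial k → Polynomial k
    ℬ-poly x = x ∧ 2 :+ x :+ con 3
    2𝒞-poly x = x ∧ 4 :+ con 2 :* x ∧ 3 :+ con 5 :* x ∧ 2 :+ con 5 :* x :+ con 4

  ℬₙ-horner : ∀ h → ℬₙ h ≡ h * h + h + 3
  ℬₙ-horner = solve 1 (λ h → ℬ-poly h := h :* h :+ h :+ con 3) refl

  -- The right side is LB + A for A = h + 1, B = h² + h + 3 and L = h² + h + 1, which is 2C when E =
  -- 2.
  2𝒞-factored : ∀ h → 2𝒞 h ≡ (h * h + h + 3) * (h * h + h + 1) + (h + 1)
  2𝒞-factored = solve 1 (λ h →
    2𝒞-poly h := (h :* h :+ h :+ con 3) :* (h :* h :+ h :+ con 1) :+ (h :+ con 1)) refl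

  -- At the extremal values the first factor on the left is pq and the second is 2r.
  2𝒩-factored : ∀ h →
    ((h + 1) * ℬₙ h * (h * h) + (h + 1 + ℬₙ h) * h + 1) * (2𝒞 h * h + 2) ≡ 2𝒩 h
  2𝒩-factored = solve 1 (λ h →
    ((h :+ con 1) :* ℬ-poly h :* (h :* h) :+ (h :+ con 1 :+ ℬ-poly h) :* h :+ con 1)
      :* (2𝒞-poly h :* h :+ con 2)
    := h ∧ 10 :+ con 4 :* h ∧ 9 :+ con 14 :* h ∧ 8 :+ con 30 :* h ∧ 7
       :+ con 53 :* h ∧ 6 :+ con 69 :* h ∧ 5 :+ con 71 :* h ∧ 4
       :+ con 55 :* h ∧ 3 :+ con 31 :* h ∧ 2 :+ con 12 :* h :+ con 2) refl

  -- Estimates for fixed G, with a slack that detects equality.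

  scaled-bound : ∀ k .{{_ : NonZero k}} {x y δ} → k * x + δ ≤ k * y → x ≤ y × (x ≡ y → δ ≡ 0)
  scaled-bound k {x} {y} {δ} kx+δ≤ky =
      *-cancelˡ-≤ k (m+n≤o⇒m≤o (k * x) kx+δ≤ky)
    -- If x = y, there is no room for δ; the same estimate thus gives the bound and its equality
    -- case.
    , λ { refl → n≤0⇒n≡0 (+-cancelˡ-≤ (k * x) δ 0
        (≤-trans kx+δ≤ky (≤-reflexive (sym (+-identityʳ (k * x)))))) }

  m+o≤n⇒k*m+o≤k*n : ∀ {k m n o} → 1 ≤ k → m + o ≤ n → k * m + o ≤ k * n
  m+o≤n⇒k*m+o≤k*n {k} {m} {n} {o} 1≤k m+o≤n = begin
    k * m + o       ≡⟨ cong (k * m +_) (*-identityˡ o) ⟨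
    k * m + 1 * o   ≤⟨ +-monoʳ-≤ (k * m) (*-monoˡ-≤ o 1≤k) ⟩
    k * m + k * o   ≡⟨ *-distribˡ-+ k m o ⟨
    k * (m + o)     ≤⟨ *-monoʳ-≤ k m+o≤n ⟩
    k * n           ∎
    where open ≤-Reasoning

  -- For fixed A, G and L = AH+1 the quantities G C, G² B C and G (B + C) decrease
  -- in E, so that they are bounded by their values at E = 2.
  module Decreasing-in-E (A B C e g L : ℕ)
    (gB : g * B ≡ 2 + e + L)
    (EC : (2 + e) * C ≡ L * B + A)
    (E<L : 2 + e < L)
    where

    private
      -- L exceeds E ≥ 2, so L is at least 3 as well as at least E. This absorbs the terms quadratic
      -- in E below.
      3E≤L² : 3 * (2 + e) ≤ L * L
      3E≤L² = *-mono-≤ (≤-trans (s≤s (m≤m+n 2 e)) E<L) (<⇒≤ E<L)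

      -- Multiplying EC = LB + A by G allows B to be eliminated through GB = E + L.
      EgC : (2 + e) * (g * C) ≡ L * (2 + e + L) + A * g
      EgC = begin
        (2 + e) * (g * C)       ≡⟨ ring (e ∷ g ∷ C ∷ []) ⟩
        g * ((2 + e) * C)       ≡⟨ cong (g *_) EC ⟩
        g * (L * B + A)         ≡⟨ ring (g ∷ L ∷ B ∷ A ∷ []) ⟩
        L * (g * B) + A * g     ≡⟨ cong (λ x → L * x + A * g) gB ⟩
        L * (2 + e + L) + A * g ∎
        where open ≡-Reasoning

    open ≤-Reasoning

    -- After multiplication by E the right side exceeds 2E · GC by exactly e (L² + AG), which covers
    -- the slack eE.
    C-bound : 2 * (g * C) + e ≤ (2 + L) * L + A * g
    C-bound = *-cancelˡ-≤ (2 + e) (begin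
      (2 + e) * (2 * (g * C) + e)
        ≡⟨ ring (e ∷ g ∷ C ∷ []) ⟩
      2 * ((2 + e) * (g * C)) + e * (2 + e)
        ≡⟨ cong (λ x → 2 * x + e * (2 + e)) EgC ⟩
      2 * (L * (2 + e + L) + A * g) + e * (2 + e)
        ≤⟨ +-monoʳ-≤ _ (*-monoʳ-≤ e
             (≤-trans (m≤n*m (2 + e) 3) (≤-trans 3E≤L² (m≤m+n (L * L) (A * g))))) ⟩
      2 * (L * (2 + e + L) + A * g) + e * (L * L + A * g)
        ≡⟨ ring (e ∷ g ∷ L ∷ A ∷ []) ⟩
      (2 + e) * ((2 + L) * L + A * g)
        ∎)

    BC-bound : 2 * (g * B * (g * C)) + e ≤ (2 + L) * ((2 + L) * L + A * g)
    -- Multiplied by E, the right side exceeds 2E · GB · GC by e (L³ + AGL - 2LE). The negative term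
    -- is moved by adding e · 2LE to both sides.
    BC-bound = *-cancelˡ-≤ (2 + e) (+-cancelʳ-≤ (e * (2 * L * (2 + e))) _ _ (begin
      (2 + e) * (2 * (g * B * (g * C)) + e) + e * (2 * L * (2 + e))
        ≡⟨ ring (e ∷ g ∷ B ∷ C ∷ L ∷ []) ⟩
      2 * (g * B * ((2 + e) * (g * C))) + e * (2 + e + 2 * L * (2 + e))
        ≡⟨ cong₂ (λ x y → 2 * (x * y) + e * (2 + e + 2 * L * (2 + e))) gB EgC ⟩
      2 * ((2 + e + L) * (L * (2 + e + L) + A * g)) + e * (2 + e + 2 * L * (2 + e))
        ≤⟨ +-monoʳ-≤ _ (*-monoʳ-≤ e E+2LE≤) ⟩
      2 * ((2 + e + L) * (L * (2 + e + L) + A * g)) + e * (L * (L * L) + A * g * L)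
        ≡⟨ ring (e ∷ g ∷ L ∷ A ∷ []) ⟩
      (2 + e) * ((2 + L) * ((2 + L) * L + A * g)) + e * (2 * L * (2 + e))
        ∎))
      where
      E+2LE≤ : 2 + e + 2 * L * (2 + e) ≤ L * (L * L) + A * g * L
      E+2LE≤ = begin
        2 + e + 2 * L * (2 + e)
          ≤⟨ +-monoˡ-≤ _ (m≤n*m (2 + e) L {{>-nonZero (≤-<-trans z≤n E<L)}}) ⟩
        L * (2 + e) + 2 * L * (2 + e)  ≡⟨ ring (e ∷ L ∷ []) ⟩
        L * (3 * (2 + e))              ≤⟨ *-monoʳ-≤ L 3E≤L² ⟩
        L * (L * L)                    ≤⟨ m≤m+n _ (A * g * L) ⟩
        L * (L * L) + A * g * L        ∎

    -- After multiplication by E the two sides differ by e (L² + AG - 2E). No slack is carried,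
    -- because `n-bound` takes its slack from `BC-bound`.
    B+C-bound : 2 * (g * B + g * C) ≤ 2 * (2 + L) + ((2 + L) * L + A * g)
    B+C-bound = *-cancelˡ-≤ (2 + e) (+-cancelʳ-≤ (e * (3 * (2 + e))) _ _ (begin
      (2 + e) * (2 * (g * B + g * C)) + e * (3 * (2 + e))
        ≡⟨ ring (e ∷ g ∷ B ∷ C ∷ []) ⟩
      2 * ((2 + e) * (g * B) + (2 + e) * (g * C)) + e * (3 * (2 + e))
        ≡⟨ cong₂ (λ x y → 2 * ((2 + e) * x + y) + e * (3 * (2 + e))) gB EgC ⟩
      2 * ((2 + e) * (2 + e + L) + (L * (2 + e + L) + A * g)) + e * (3 * (2 + e))
        ≤⟨ +-monoʳ-≤ _ (*-monoʳ-≤ e (≤-trans 3E≤L² (m≤m+n (L * L) (A * g + (2 + e))))) ⟩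
      2 * ((2 + e) * (2 + e + L) + (L * (2 + e + L) + A * g)) + e * (L * L + (A * g + (2 + e)))
        ≡⟨ ring (e ∷ g ∷ L ∷ A ∷ []) ⟩
      (2 + e) * (2 * (2 + L) + ((2 + L) * L + A * g)) + e * (3 * (2 + e))
        ∎))

  -- At E = 2 and A = G + H the values of C, AB and A + B are convex in G and agree
  -- at G = 1 and G = H² + 3, while 1 ≤ G < H² + 3. Every bound is multiplied by G.
  module Convex-in-G (A h γ t u : ℕ)
    (A+t : A + t ≡ suc γ + h)
    (g+u : suc γ + suc u ≡ h * h + 3)
    where

    private
      A≤ : A ≤ suc γ + h
      A≤ = m+n≤o⇒m≤o A (≤-reflexive A+t)

    open ≤-Reasoning

    -- At A = G + h the right side exceeds the left side without its slack by γ (h² + 1) (h² + 3 -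
    -- G), which vanishes at G = 1 and G = h² + 3 and is at least γ in between. A smaller A leaves
    -- room for t in the term AG.
    C-bound : (2 + suc (h * A)) * suc (h * A) + A * suc γ + (γ + t) ≤ suc γ * 2𝒞 h
    C-bound = +-cancelʳ-≤ (γ * (suc γ * (h * h + 1))) _ _ (begin
      (2 + suc (h * A)) * suc (h * A) + A * suc γ + (γ + t) + γ * (suc γ * (h * h + 1))
        ≡⟨ regroup ((2 + suc (h * A)) * suc (h * A)) (A * suc γ) ⟩
      (2 + suc (h * A)) * suc (h * A) + (A * suc γ + t) + γ * (1 + suc γ * (h * h + 1))
        ≤⟨ +-mono-≤ (+-mono-≤ (*-mono-≤ (+-monoʳ-≤ 2 L≤) L≤) Ag+t≤) (*-monoʳ-≤ γ slack) ⟩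
      (2 + suc (h * (suc γ + h))) * suc (h * (suc γ + h)) + (suc γ + h) * suc γ
          + γ * ((h * h + 1) * (h * h + 3))
        ≡⟨ ring (h ∷ γ ∷ []) ⟩
      suc γ * ((h * h + h + 3) * (h * h + h + 1) + (h + 1)) + γ * (suc γ * (h * h + 1))
        ≡⟨ cong (λ x → suc γ * x + γ * (suc γ * (h * h + 1))) (2𝒞-factored h) ⟨
      suc γ * 2𝒞 h + γ * (suc γ * (h * h + 1))
        ∎)
      where
      L≤ : suc (h * A) ≤ suc (h * (suc γ + h))
      L≤ = s≤s (*-monoʳ-≤ h A≤)

      regroup : ∀ x y → x + y + (γ + t) + γ * (suc γ * (h * h + 1))
                      ≡ x + (y + t) + γ * (1 + suc γ * (h * h + 1))
      regroup x y = ring (x ∷ y ∷ γ ∷ t ∷ h ∷ [])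

      Ag+t≤ : A * suc γ + t ≤ (suc γ + h) * suc γ
      Ag+t≤ = begin
        A * suc γ + t          ≤⟨ +-monoʳ-≤ (A * suc γ) (m≤m*n t (suc γ)) ⟩
        A * suc γ + t * suc γ  ≡⟨ *-distribʳ-+ (suc γ) A t ⟨
        (A + t) * suc γ        ≡⟨ cong (_* suc γ) A+t ⟩
        (suc γ + h) * suc γ    ∎

      slack : 1 + suc γ * (h * h + 1) ≤ (h * h + 1) * (h * h + 3)
      slack = begin
        1 + suc γ * (h * h + 1)
          ≤⟨ m≤m+n _ (h * h + (h * h + 1) * u) ⟩
        1 + suc γ * (h * h + 1) + (h * h + (h * h + 1) * u)
          ≡⟨ ring (γ ∷ h ∷ u ∷ []) ⟩
        (h * h + 1) * (suc γ + suc u)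
          ≡⟨ cong ((h * h + 1) *_) g+u ⟩
        (h * h + 1) * (h * h + 3)
          ∎

    -- At A = G + h the difference of the two sides is γ (h² + 3).
    B-bound : 2 + suc (h * A) ≤ suc γ * ℬₙ h
    B-bound = begin
      2 + suc (h * A)                              ≤⟨ +-monoʳ-≤ 3 (*-monoʳ-≤ h A≤) ⟩
      3 + h * (suc γ + h)                          ≤⟨ m≤m+n _ (γ * (h * h + 3)) ⟩
      3 + h * (suc γ + h) + γ * (h * h + 3)        ≡⟨ ring (h ∷ γ ∷ []) ⟩
      suc γ * (h * h + h + 3)                      ≡⟨ cong (suc γ *_) (ℬₙ-horner h) ⟨
      suc γ * ℬₙ h                                 ∎

    private
      γg≤ : γ * suc γ ≤ γ * (h * h + 3)
      γg≤ = *-monoʳ-≤ γ (m+n≤o⇒m≤o (suc γ) (≤-reflexive g+u))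

    -- At A = G + h the difference is h γ (h² + 3 - G).
    AB-bound : A * (2 + suc (h * A)) ≤ suc γ * ((h + 1) * ℬₙ h)
    AB-bound = +-cancelʳ-≤ (h * (γ * suc γ)) _ _ (begin
      A * (2 + suc (h * A)) + h * (γ * suc γ)
        ≤⟨ +-mono-≤ (*-mono-≤ A≤ (+-monoʳ-≤ 3 (*-monoʳ-≤ h A≤))) (*-monoʳ-≤ h γg≤) ⟩
      (suc γ + h) * (3 + h * (suc γ + h)) + h * (γ * (h * h + 3))
        ≡⟨ ring (h ∷ γ ∷ []) ⟩
      suc γ * ((h + 1) * (h * h + h + 3)) + h * (γ * suc γ)
        ≡⟨ cong (λ x → suc γ * ((h + 1) * x) + h * (γ * suc γ)) (ℬₙ-horner h) ⟨
      suc γ * ((h + 1) * ℬₙ h) + h * (γ * suc γ)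
        ∎)

    -- At A = G + h the difference is γ (h² + 3 - G).
    A+B-bound : suc γ * A + (2 + suc (h * A)) ≤ suc γ * (h + 1 + ℬₙ h)
    A+B-bound = +-cancelʳ-≤ (γ * suc γ) _ _ (begin
      suc γ * A + (2 + suc (h * A)) + γ * suc γ
        ≤⟨ +-mono-≤ (+-mono-≤ (*-monoʳ-≤ (suc γ) A≤) (+-monoʳ-≤ 3 (*-monoʳ-≤ h A≤))) γg≤ ⟩
      suc γ * (suc γ + h) + (3 + h * (suc γ + h)) + γ * (h * h + 3)
        ≡⟨ ring (h ∷ γ ∷ []) ⟩
      suc γ * (h + 1 + (h * h + h + 3)) + γ * suc γ
        ≡⟨ cong (λ x → suc γ * (h + 1 + x) + γ * suc γ) (ℬₙ-horner h) ⟨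
      suc γ * (h + 1 + ℬₙ h) + γ * suc γ
        ∎)

  -- The four bounds, from monotonicity in E and convexity in G.

  module Bounds (A B C e γ h t u : ℕ) (1≤A : 1 ≤ A) (1≤h : 1 ≤ h)
    (gB : suc γ * B ≡ 2 + e + suc (h * A))
    (EC : (2 + e) * C ≡ suc (h * A) * B + A)
    (E<L : 2 + e < suc (h * A))
    (A+t : A + t ≡ suc γ + h)
    (g+u : suc γ + suc u ≡ h * h + 3)
    where

    private
      module E = Decreasing-in-E A B C e (suc γ) (suc (h * A)) gB EC E<L
      module G = Convex-in-G A h γ t u A+t g+u

      -- b / g and c / 2g are the values of B and C for the given A and G at E = 2.
      -- The slack δ vanishes only at E = 2, G = 1, A = G + H, and carrying it through
      -- the estimates makes them strict in all other cases.
      b c δ : ℕ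
      b = 2 + suc (h * A)
      c = (2 + suc (h * A)) * suc (h * A) + A * suc γ
      δ = e + (γ + t)

    open ≤-Reasoning

    private
      -- The common last step of the bounds on products: a bound in terms of c, at E = 2, becomes
      -- one in terms of `2𝒞`. As k ≥ 1, the slack γ + t of `G.C-bound` survives multiplication by
      -- k.
      via-c : ∀ k {k′} .{{_ : NonZero k}} {x} m → x + e ≤ k * c + m → k ≤ suc γ * k′ →
              x + δ ≤ suc γ * k′ * (suc γ * 2𝒞 h) + m
      via-c k {k′} {x} m x+e≤ k≤ = begin
        x + δ                                 ≡⟨ +-assoc x e (γ + t) ⟨
        x + e + (γ + t)                       ≤⟨ +-mono-≤ x+e≤ (m≤n*m (γ + t) k) ⟩
        k * c + m + k * (γ + t)               ≡⟨ regroup c ⟩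
        k * (c + (γ + t)) + m                 ≤⟨ +-monoˡ-≤ m (*-mono-≤ k≤ G.C-bound) ⟩
        suc γ * k′ * (suc γ * 2𝒞 h) + m       ∎
        where
        regroup : ∀ c → k * c + m + k * (γ + t) ≡ k * (c + (γ + t)) + m
        regroup c = ring (k ∷ c ∷ m ∷ γ ∷ t ∷ [])

    C-bound : 2 * C ≤ 2𝒞 h × (2 * C ≡ 2𝒞 h → δ ≡ 0)
    C-bound = scaled-bound (suc γ) (begin
      suc γ * (2 * C) + (e + (γ + t))  ≡⟨ ring (γ ∷ C ∷ e ∷ t ∷ []) ⟩
      2 * (suc γ * C) + e + (γ + t)    ≤⟨ +-monoˡ-≤ (γ + t) E.C-bound ⟩
      c + (γ + t)                      ≤⟨ G.C-bound ⟩
      suc γ * 2𝒞 h                     ∎)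

    BC-bound : 2 * (B * C) ≤ ℬₙ h * 2𝒞 h × (2 * (B * C) ≡ ℬₙ h * 2𝒞 h → δ ≡ 0)
    BC-bound = scaled-bound (suc γ * suc γ) (begin
      suc γ * suc γ * (2 * (B * C)) + δ
        ≡⟨ cong (_+ δ) (rearrange B C) ⟩
      2 * (suc γ * B * (suc γ * C)) + δ
        ≤⟨ via-c b 0 (≤-trans E.BC-bound (≤-reflexive (sym (+-identityʳ (b * c))))) G.B-bound ⟩
      suc γ * ℬₙ h * (suc γ * 2𝒞 h) + 0
        ≡⟨ collect (ℬₙ h) (2𝒞 h) ⟩
      suc γ * suc γ * (ℬₙ h * 2𝒞 h)
        ∎)
      where
      rearrange : ∀ B C → suc γ * suc γ * (2 * (B * C)) ≡ 2 * (suc γ * B * (suc γ * C))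
      rearrange B C = ring (γ ∷ B ∷ C ∷ [])
      collect : ∀ x y → suc γ * x * (suc γ * y) + 0 ≡ suc γ * suc γ * (x * y)
      collect x y = ring (γ ∷ x ∷ y ∷ [])

    ABC-bound : 2 * (A * B * C) ≤ (h + 1) * ℬₙ h * 2𝒞 h
              × (2 * (A * B * C) ≡ (h + 1) * ℬₙ h * 2𝒞 h → δ ≡ 0)
    ABC-bound = scaled-bound (suc γ * suc γ) (begin
      suc γ * suc γ * (2 * (A * B * C)) + δ
        ≡⟨ cong (_+ δ) (rearrange B C) ⟩
      A * (2 * (suc γ * B * (suc γ * C))) + δ
        ≤⟨ via-c (A * b) {{m*n≢0 A b {{>-nonZero 1≤A}}}} 0
             (≤-trans (m+o≤n⇒k*m+o≤k*n 1≤A E.BC-bound) (≤-reflexive (reassoc b c))) G.AB-bound ⟩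
      suc γ * ((h + 1) * ℬₙ h) * (suc γ * 2𝒞 h) + 0
        ≡⟨ collect (ℬₙ h) (2𝒞 h) ⟩
      suc γ * suc γ * ((h + 1) * ℬₙ h * 2𝒞 h)
        ∎)
      where
      rearrange : ∀ B C → suc γ * suc γ * (2 * (A * B * C)) ≡ A * (2 * (suc γ * B * (suc γ * C)))
      rearrange B C = ring (γ ∷ A ∷ B ∷ C ∷ [])
      reassoc : ∀ b c → A * (b * c) ≡ A * b * c + 0
      reassoc b c = ring (A ∷ b ∷ c ∷ [])
      collect : ∀ x y → suc γ * ((h + 1) * x) * (suc γ * y) + 0 ≡ suc γ * suc γ * ((h + 1) * x * y)
      collect x y = ring (γ ∷ h ∷ x ∷ y ∷ [])

    n-bound : let n = suc (A * h) * suc (B * h) * suc (C * h) in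
              2 * n ≤ 2𝒩 h × (2 * n ≡ 2𝒩 h → δ ≡ 0)
    n-bound = subst (λ x → 2 * n ≤ x × (2 * n ≡ x → δ ≡ 0)) (2𝒩-factored h)
      (scaled-bound (suc γ * suc γ) (begin
        suc γ * suc γ * (2 * n) + δ
          ≡⟨ cong (_+ δ) (expand B C) ⟩
        L * W + δ
          ≤⟨ via-c (Y * h) {Z * h} {{m*n≢0 Y h {{Y≢0}} {{h≢0}}}} {L * W} (2 * suc γ * Y)
               (≤-trans (m+o≤n⇒k*m+o≤k*n {L} {W} (s≤s z≤n) inner) (≤-reflexive (factor b c))) Yh≤ ⟩
        suc γ * (Z * h) * (suc γ * 2𝒞 h) + 2 * suc γ * Y
          ≤⟨ +-monoʳ-≤ (suc γ * (Z * h) * (suc γ * 2𝒞 h)) (*-monoʳ-≤ (2 * suc γ) Y≤) ⟩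
        suc γ * (Z * h) * (suc γ * 2𝒞 h) + 2 * suc γ * (suc γ * Z)
          ≡⟨ collect Z (2𝒞 h) ⟩
        suc γ * suc γ * (Z * (2𝒞 h * h + 2))
          ∎))
      where
      n L X₂ X₃ W Y Z : ℕ
      n  = suc (A * h) * suc (B * h) * suc (C * h)
      L  = suc (h * A)
      X₂ = 2 * (suc γ * B * (suc γ * C))
      X₃ = 2 * (suc γ * B + suc γ * C)
      -- W is 2G² qr and L is p. Y is G pq with b in place of GB, and Z is pq at the extremal
      -- values.
      W  = h * h * X₂ + (suc γ * h * X₃ + 2 * (suc γ * suc γ))
      Y  = A * b * (h * h) + (suc γ * A + b) * h + suc γ
      Z  = (h + 1) * ℬₙ h * (h * h) + (h + 1 + ℬₙ h) * h + 1

      h≢0 : NonZero h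
      h≢0 = >-nonZero 1≤h

      Y≢0 : NonZero Y
      Y≢0 = >-nonZero (≤-trans (s≤s z≤n) (m≤n+m (suc γ) _))

      expand : ∀ B C →
        suc γ * suc γ * (2 * (suc (A * h) * suc (B * h) * suc (C * h))) ≡
        suc (h * A) * (h * h * (2 * (suc γ * B * (suc γ * C)))
                      + (suc γ * h * (2 * (suc γ * B + suc γ * C)) + 2 * (suc γ * suc γ)))
      expand B C = ring (γ ∷ A ∷ B ∷ C ∷ h ∷ [])

      inner : W + e ≤
              h * h * (b * c) + (suc γ * h * (2 * b + c) + 2 * (suc γ * suc γ))
      inner = begin
        W + e
          ≡⟨ swap (h * h * X₂) (suc γ * h * X₃ + 2 * (suc γ * suc γ)) ⟩
        h * h * X₂ + e + (suc γ * h * X₃ + 2 * (suc γ * suc γ))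
          -- The slack e enters through the BC term alone, whose coefficient h² is at least 1.
          ≤⟨ +-mono-≤ (m+o≤n⇒k*m+o≤k*n (*-mono-≤ 1≤h 1≤h) E.BC-bound)
                      (+-monoˡ-≤ _ (*-monoʳ-≤ (suc γ * h) E.B+C-bound)) ⟩
        h * h * (b * c) + (suc γ * h * (2 * b + c) + 2 * (suc γ * suc γ))
          ∎
        where
        swap : ∀ x y → x + y + e ≡ x + e + y
        swap x y = ring (x ∷ y ∷ e ∷ [])

      -- The bound on W is (hb + G) (hc + 2G), and L (hb + G) is Y.
      factor : ∀ b c →
        suc (h * A) * (h * h * (b * c) + (suc γ * h * (2 * b + c) + 2 * (suc γ * suc γ))) ≡
        (A * b * (h * h) + (suc γ * A + b) * h + suc γ) * h * c
        + 2 * suc γ * (A * b * (h * h) + (suc γ * A + b) * h + suc γ)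
      factor b c = ring (γ ∷ A ∷ h ∷ b ∷ c ∷ [])

      Y≤ : Y ≤ suc γ * Z
      Y≤ = begin
        A * b * (h * h) + (suc γ * A + b) * h + suc γ
          ≤⟨ +-monoˡ-≤ (suc γ)
               (+-mono-≤ (*-monoˡ-≤ (h * h) G.AB-bound) (*-monoˡ-≤ h G.A+B-bound)) ⟩
        suc γ * ((h + 1) * ℬₙ h) * (h * h) + suc γ * (h + 1 + ℬₙ h) * h + suc γ
          ≡⟨ distrib (ℬₙ h) ⟩
        suc γ * ((h + 1) * ℬₙ h * (h * h) + (h + 1 + ℬₙ h) * h + 1)
          ∎
        where
        distrib : ∀ x → suc γ * ((h + 1) * x) * (h * h) + suc γ * (h + 1 + x) * h + suc γ ≡
                        suc γ * ((h + 1) * x * (h * h) + (h + 1 + x) * h + 1)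
        distrib x = ring (γ ∷ h ∷ x ∷ [])

      Yh≤ : Y * h ≤ suc γ * (Z * h)
      Yh≤ = ≤-trans (*-monoˡ-≤ h Y≤) (≤-reflexive (*-assoc (suc γ) Z h))

      collect : ∀ Z x → suc γ * (Z * h) * (suc γ * x) + 2 * suc γ * (suc γ * Z) ≡
                        suc γ * suc γ * (Z * (x * h + 2))
      collect Z x = ring (γ ∷ h ∷ Z ∷ x ∷ [])

  -- The values at E = 2, F = G = 1.

  module Equality (A B C h : ℕ)
    (A≡ : A ≡ h + 1) (gB : B ≡ 3 + h * A) (EC : 2 * C ≡ suc (h * A) * B + A) where

    open ≡-Reasoning

    private
      B-expand : B ≡ h * h + h + 3
      B-expand = begin
        B                ≡⟨ gB ⟩
        3 + h * A        ≡⟨ cong (λ x → 3 + h * x) A≡ ⟩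
        3 + h * (h + 1)  ≡⟨ ring (h ∷ []) ⟩
        h * h + h + 3    ∎

      B≡ : B ≡ ℬₙ h
      B≡ = trans B-expand (sym (ℬₙ-horner h))

    C-equality : 2 * C ≡ 2𝒞 h
    C-equality = begin
      2 * C
        ≡⟨ EC ⟩
      suc (h * A) * B + A
        ≡⟨ cong₂ (λ x y → suc (h * x) * y + x) A≡ B-expand ⟩
      suc (h * (h + 1)) * (h * h + h + 3) + (h + 1)
        ≡⟨ ring (h ∷ []) ⟩
      (h * h + h + 3) * (h * h + h + 1) + (h + 1)
        ≡⟨ 2𝒞-factored h ⟨
      2𝒞 h
        ∎

    BC-equality : 2 * (B * C) ≡ ℬₙ h * 2𝒞 h
    BC-equality = begin
      2 * (B * C)      ≡⟨ ring (B ∷ C ∷ []) ⟩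
      B * (2 * C)      ≡⟨ cong₂ _*_ B≡ C-equality ⟩
      ℬₙ h * 2𝒞 h      ∎

    ABC-equality : 2 * (A * B * C) ≡ (h + 1) * ℬₙ h * 2𝒞 h
    ABC-equality = begin
      2 * (A * B * C)          ≡⟨ ring (A ∷ B ∷ C ∷ []) ⟩
      A * B * (2 * C)          ≡⟨ cong₂ _*_ (cong₂ _*_ A≡ B≡) C-equality ⟩
      (h + 1) * ℬₙ h * 2𝒞 h    ∎

    n-equality : 2 * (suc (A * h) * suc (B * h) * suc (C * h)) ≡ 2𝒩 h
    n-equality = begin
      2 * (suc (A * h) * suc (B * h) * suc (C * h))
        ≡⟨ ring (A ∷ B ∷ C ∷ h ∷ []) ⟩
      (A * B * (h * h) + (A + B) * h + 1) * (2 * C * h + 2)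
        ≡⟨ cong₂ (λ x y → (x * B * (h * h) + (x + B) * h + 1) * (y * h + 2)) A≡ C-equality ⟩
      ((h + 1) * B * (h * h) + (h + 1 + B) * h + 1) * (2𝒞 h * h + 2)
        ≡⟨ cong (λ x → ((h + 1) * x * (h * h) + (h + 1 + x) * h + 1) * (2𝒞 h * h + 2)) B≡ ⟩
      ((h + 1) * ℬₙ h * (h * h) + (h + 1 + ℬₙ h) * h + 1) * (2𝒞 h * h + 2)
        ≡⟨ 2𝒩-factored h ⟩
      2𝒩 h
        ∎

  -- The range of E and G, and the characterisation of equality.

  module Extremal (A B C E f g h : ℕ)
    (1≤A : 1 ≤ A) (A<B : A < B) (B<C : B < C) (2≤E : 2 ≤ E) (1≤h : 1 ≤ h)
    (fA : f * A ≡ g + h)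
    (gB : g * B ≡ E + suc (h * A))
    (EC : E * C ≡ suc (h * A) * B + A)
    where

    open ≤-Reasoning

    A<L : A < suc (h * A)
    A<L = s≤s (m≤n*m A h {{>-nonZero 1≤h}})

    -- Otherwise EC ≥ L (B + 1) = LB + L > LB + A, because C > B and L > A.
    E<L : E < suc (h * A)
    E<L = ≰⇒> λ L≤E → n≮n (E * C) (begin-strict
      E * C                              ≡⟨ EC ⟩
      suc (h * A) * B + A                <⟨ +-monoʳ-< _ A<L ⟩
      suc (h * A) * B + suc (h * A)      ≡⟨ +-comm (suc (h * A) * B) (suc (h * A)) ⟩
      suc (h * A) + suc (h * A) * B      ≡⟨ *-suc (suc (h * A)) B ⟨
      suc (h * A) * suc B                ≤⟨ *-mono-≤ L≤E B<C ⟩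
      E * C                              ∎)

    -- Otherwise GB ≥ 2h (A + 1) ≥ 2hA + 2 = 2L, because B > A, whereas GB = E + L < 2L.
    g<2h : g < 2 * h
    g<2h = ≰⇒> λ 2h≤g → n≮n (g * B) (begin-strict
      g * B                              ≡⟨ gB ⟩
      E + suc (h * A)                    <⟨ +-monoˡ-< (suc (h * A)) E<L ⟩
      suc (h * A) + suc (h * A)          ≡⟨ ring (h ∷ A ∷ []) ⟩
      2 * h * A + 2 * 1                  ≤⟨ +-monoʳ-≤ (2 * h * A) (*-monoʳ-≤ 2 1≤h) ⟩
      2 * h * A + 2 * h                  ≡⟨ ring (h ∷ A ∷ []) ⟩
      2 * h * suc A                      ≤⟨ *-mono-≤ 2h≤g A<B ⟩
      g * B                              ∎)

    -- Places G below h² + 3, the second point where the convex functions agree with their bounds.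
    2h≤h²+3 : ∀ h → 2 * h ≤ h * h + 3
    2h≤h²+3 zero          = z≤n
    2h≤h²+3 (suc zero)    = s≤s (s≤s z≤n)
    2h≤h²+3 (suc (suc h)) = ≤-trans (*-monoˡ-≤ (2 + h) {2} {2 + h} (s≤s (s≤s z≤n))) (m≤m+n _ 3)

    1≤g : 1 ≤ g
    1≤g = n≢0⇒n>0 λ { refl → 1+n≢0 (trans (sym (+-suc E (h * A))) (sym gB)) }

    1≤f : 1 ≤ f
    1≤f = n≢0⇒n>0 λ { refl → n≮0 (≤-trans 1≤g (m+n≤o⇒m≤o g (≤-reflexive (sym fA)))) }

    -- The distances of E, G, A and G from 2, 1, G + h and h² + 2. All four subtractions are exact,
    -- by 2 ≤ E, 1 ≤ G, A ≤ FA = G + h and G < 2h ≤ h² + 3.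
    e γ t u : ℕ
    e = E ∸ 2
    γ = g ∸ 1
    t = g + h ∸ A
    u = h * h + 3 ∸ suc g

    E≡2+e : 2 + e ≡ E
    E≡2+e = m+[n∸m]≡n 2≤E

    g≡1+γ : suc γ ≡ g
    g≡1+γ = m+[n∸m]≡n 1≤g

    A+t : A + t ≡ suc γ + h
    A+t = trans (m+[n∸m]≡n A≤g+h) (cong (_+ h) (sym g≡1+γ))
      where
      A≤g+h : A ≤ g + h
      A≤g+h = ≤-trans (m≤n*m A f {{>-nonZero 1≤f}}) (≤-reflexive fA)

    g+u : suc γ + suc u ≡ h * h + 3
    g+u = trans (cong (_+ suc u) g≡1+γ)
      (trans (+-suc g u) (m+[n∸m]≡n (≤-trans g<2h (2h≤h²+3 h))))

    IsExtremal : Set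
    IsExtremal = E ≡ 2 × f ≡ 1 × g ≡ 1

    -- All three summands vanish. From t = 0 follows A = G + h = FA, and therefore F = 1.
    slack≡0⇒extremal : e + (γ + t) ≡ 0 → IsExtremal
    slack≡0⇒extremal eq =
        trans (sym E≡2+e) (cong (2 +_) e≡0)
      , *-cancelʳ-≡ f 1 A {{>-nonZero 1≤A}} fA≡A
      , trans (sym g≡1+γ) (cong suc γ≡0)
      where
      e≡0 : e ≡ 0
      e≡0 = m+n≡0⇒m≡0 e eq
      γ≡0 : γ ≡ 0
      γ≡0 = m+n≡0⇒m≡0 γ (m+n≡0⇒n≡0 e eq)
      t≡0 : t ≡ 0
      t≡0 = m+n≡0⇒n≡0 γ (m+n≡0⇒n≡0 e eq)
      fA≡A : f * A ≡ 1 * A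
      fA≡A = ≡.begin
        f * A      ≡.≡⟨ fA ⟩
        g + h      ≡.≡⟨ cong (_+ h) g≡1+γ ⟨
        suc γ + h  ≡.≡⟨ A+t ⟨
        A + t      ≡.≡⟨ cong (A +_) t≡0 ⟩
        A + 0      ≡.≡⟨ +-comm A 0 ⟩
        A          ≡.≡⟨ *-identityˡ A ⟨
        1 * A      ≡.∎
        where module ≡ = ≡-Reasoning

    module B′ = Bounds A B C e γ h t u 1≤A 1≤h
      (trans (cong (_* B) g≡1+γ) (trans gB (cong (_+ suc (h * A)) (sym E≡2+e))))
      (trans (cong (_* C) E≡2+e) EC)
      (subst (_< suc (h * A)) (sym E≡2+e) E<L)
      A+t g+u

    extremal⇒A : IsExtremal → A ≡ h + 1
    extremal⇒A (_ , refl , refl) = trans (sym (*-identityˡ A)) (trans fA (+-comm 1 h))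

    extremal⇒B : IsExtremal → B ≡ 3 + h * A
    extremal⇒B (refl , _ , refl) = trans (sym (*-identityˡ B)) gB

    extremal⇒C : IsExtremal → 2 * C ≡ suc (h * A) * B + A
    extremal⇒C (refl , _ , _) = EC

    module E′ (x : IsExtremal) = Equality A B C h (extremal⇒A x) (extremal⇒B x) (extremal⇒C x)

    package : ∀ {m d} → m ≤ d × (m ≡ d → e + (γ + t) ≡ 0) → (IsExtremal → m ≡ d) →
              m ≤ d × (m ≡ d ⇔ IsExtremal)
    package (m≤d , slack≡0) eq = m≤d , mk⇔ (λ m≡d → slack≡0⇒extremal (slack≡0 m≡d)) eq

    C-extremal : 2 * C ≤ 2𝒞 h × (2 * C ≡ 2𝒞 h ⇔ IsExtremal)
    C-extremal = package B′.C-bound E′.C-equality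

    BC-extremal : 2 * (B * C) ≤ ℬₙ h * 2𝒞 h × (2 * (B * C) ≡ ℬₙ h * 2𝒞 h ⇔ IsExtremal)
    BC-extremal = package B′.BC-bound E′.BC-equality

    ABC-extremal : 2 * (A * B * C) ≤ (h + 1) * ℬₙ h * 2𝒞 h
                 × (2 * (A * B * C) ≡ (h + 1) * ℬₙ h * 2𝒞 h ⇔ IsExtremal)
    ABC-extremal = package B′.ABC-bound E′.ABC-equality

    n-extremal : let n = suc (A * h) * suc (B * h) * suc (C * h) in
                 2 * n ≤ 2𝒩 h × (2 * n ≡ 2𝒩 h ⇔ IsExtremal)
    n-extremal = package B′.n-bound E′.n-equality

-- Passage from natural to rational numbers.

open NaturalNumbers
open import Data.Integer.Base as ℤ using (+_; 1ℤ; +≤+)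
import Data.Integer.Properties as ℤₚ
open import Data.Rational.Base using (ℚ; ½; 1ℚ; _≤_; _*_; _+_; _-_; _/_; fromℚᵘ; toℚᵘ)
open import Data.Rational.Properties as ℚₚ
  using (fromℚᵘ-cong; toℚᵘ-fromℚᵘ; toℚᵘ-injective; toℚᵘ-homo-+; toℚᵘ-homo-*)
open import Data.Rational.Solver using (module +-*-Solver)
open import Data.Rational.Unnormalised.Base as ℚᵘ using (mkℚᵘ; *≡*; *≤*)
import Data.Rational.Unnormalised.Properties as ℚᵘₚ

-- Both `ι n` and `1ℤ / m` are normalised fractions of this form, so identities between them reduce
-- to cross-multiplication of unnormalised fractions.
fromℚᵘ-homo-* : ∀ x y → fromℚᵘ (x ℚᵘ.* y) ≡ fromℚᵘ x * fromℚᵘ y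
fromℚᵘ-homo-* x y = toℚᵘ-injective (begin
  toℚᵘ (fromℚᵘ (x ℚᵘ.* y))              ≈⟨ toℚᵘ-fromℚᵘ (x ℚᵘ.* y) ⟩
  x ℚᵘ.* y                              ≈⟨ ℚᵘₚ.*-cong (toℚᵘ-fromℚᵘ x) (toℚᵘ-fromℚᵘ y) ⟨
  toℚᵘ (fromℚᵘ x) ℚᵘ.* toℚᵘ (fromℚᵘ y)  ≈⟨ toℚᵘ-homo-* (fromℚᵘ x) (fromℚᵘ y) ⟨
  toℚᵘ (fromℚᵘ x * fromℚᵘ y)            ∎)
  where open ℚᵘₚ.≃-Reasoning

fromℚᵘ-homo-+ : ∀ x y → fromℚᵘ (x ℚᵘ.+ y) ≡ fromℚᵘ x + fromℚᵘ y
fromℚᵘ-homo-+ x y = toℚᵘ-injective (begin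
  toℚᵘ (fromℚᵘ (x ℚᵘ.+ y))              ≈⟨ toℚᵘ-fromℚᵘ (x ℚᵘ.+ y) ⟩
  x ℚᵘ.+ y                              ≈⟨ ℚᵘₚ.+-cong (toℚᵘ-fromℚᵘ x) (toℚᵘ-fromℚᵘ y) ⟨
  toℚᵘ (fromℚᵘ x) ℚᵘ.+ toℚᵘ (fromℚᵘ y)  ≈⟨ toℚᵘ-homo-+ (fromℚᵘ x) (fromℚᵘ y) ⟨
  toℚᵘ (fromℚᵘ x + fromℚᵘ y)            ∎)
  where open ℚᵘₚ.≃-Reasoning

ι-homo-* : ∀ m n → ι (m ℕ.* n) ≡ ι m * ι n
ι-homo-* m n = trans
  (fromℚᵘ-cong {mkℚᵘ (+ (m ℕ.* n)) 0} {mkℚᵘ (+ m) 0 ℚᵘ.* mkℚᵘ (+ n) 0}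
    (*≡* (cong (ℤ._* 1ℤ) (ℤₚ.pos-* m n))))
  (fromℚᵘ-homo-* (mkℚᵘ (+ m) 0) (mkℚᵘ (+ n) 0))

ι-homo-+ : ∀ m n → ι (m ℕ.+ n) ≡ ι m + ι n
ι-homo-+ m n = trans
  (fromℚᵘ-cong {mkℚᵘ (+ (m ℕ.+ n)) 0} {mkℚᵘ (+ m) 0 ℚᵘ.+ mkℚᵘ (+ n) 0}
    (*≡* (cong (ℤ._* 1ℤ) (trans (ℤₚ.pos-+ m n)
      (sym (cong₂ ℤ._+_ (ℤₚ.*-identityʳ (+ m)) (ℤₚ.*-identityʳ (+ n))))))))
  (fromℚᵘ-homo-+ (mkℚᵘ (+ m) 0) (mkℚᵘ (+ n) 0))

ι-injective : ∀ {m n} → ι m ≡ ι n → m ≡ n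
ι-injective {m} {n} eq with ℚₚ.fromℚᵘ-injective {mkℚᵘ (+ m) 0} {mkℚᵘ (+ n) 0} eq
... | *≡* m*1≡n*1 = ℤₚ.+-injective (ℤₚ.*-cancelʳ-≡ (+ m) (+ n) 1ℤ m*1≡n*1)

ι-mono-≤ : ∀ {m n} → m ℕ.≤ n → ι m ≤ ι n
ι-mono-≤ {m} {n} m≤n = ℚₚ.toℚᵘ-cancel-≤ (begin
  toℚᵘ (ι m)    ≃⟨ toℚᵘ-fromℚᵘ (mkℚᵘ (+ m) 0) ⟩
  mkℚᵘ (+ m) 0  ≤⟨ *≤* (ℤₚ.*-monoʳ-≤-nonNeg 1ℤ (+≤+ m≤n)) ⟩
  mkℚᵘ (+ n) 0  ≃⟨ toℚᵘ-fromℚᵘ (mkℚᵘ (+ n) 0) ⟨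
  toℚᵘ (ι n)    ∎)
  where open ℚᵘₚ.≤-Reasoning

½*ι[2*m] : ∀ m → ½ * ι (2 ℕ.* m) ≡ ι m
½*ι[2*m] m = begin
  ½ * ι (2 ℕ.* m)   ≡⟨ cong (½ *_) (ι-homo-* 2 m) ⟩
  ½ * (ι 2 * ι m)   ≡⟨ ℚₚ.*-assoc ½ (ι 2) (ι m) ⟨
  1ℚ * ι m          ≡⟨ ℚₚ.*-identityˡ (ι m) ⟩
  ι m               ∎
  where open ≡-Reasoning

1/-inverse : ∀ m .{{_ : NonZero m}} → ι m * (1ℤ / m) ≡ 1ℚ
1/-inverse (suc m) = trans
  (sym (fromℚᵘ-homo-* (mkℚᵘ (+ suc m) 0) (mkℚᵘ 1ℤ m)))
  (fromℚᵘ-cong {mkℚᵘ (+ suc m) 0 ℚᵘ.* mkℚᵘ 1ℤ m} {mkℚᵘ 1ℤ 0} (*≡* (cong +_ (begin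
    suc m ℕ.* 1 ℕ.* 1    ≡⟨ ℕₚ.*-identityʳ (suc m ℕ.* 1) ⟩
    suc m ℕ.* 1          ≡⟨ ℕₚ.*-comm (suc m) 1 ⟩
    1 ℕ.* suc m          ≡⟨ ℕₚ.*-identityˡ (1 ℕ.* suc m) ⟨
    1 ℕ.* (1 ℕ.* suc m)  ∎))))
  where open ≡-Reasoning

1/-homo-* : ∀ m n .{{_ : NonZero m}} .{{_ : NonZero n}} .{{_ : NonZero (m ℕ.* n)}} →
            1ℤ / (m ℕ.* n) ≡ (1ℤ / m) * (1ℤ / n)
1/-homo-* (suc m) (suc n) = fromℚᵘ-homo-* (mkℚᵘ 1ℤ m) (mkℚᵘ 1ℤ n)

F-integral : ∀ (κ : K₃N) → let open K₃N κ in ∀ f →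
  f ℕ.* (A ℕ.* B ℕ.* C) ≡ H ℕ.* (B ℕ.* C ℕ.+ A ℕ.* C ℕ.+ A ℕ.* B) ℕ.+ C ℕ.+ B ℕ.+ A →
  F ≡ ι f
F-integral κ f eq = begin
  F                                ≡⟨ F-expand ⟩
  Φ 1ℚ 1ℚ 1ℚ                       ≡⟨ Φ-cong (1/-inverse A) (1/-inverse B) (1/-inverse C) ⟨
  Φ (x * a) (y * b) (z * c)        ≡⟨ clear-denominators ⟩
  N * (a * b * c)                  ≡⟨ cong (_* (a * b * c)) N-eq ⟩
  ι f * (x * y * z) * (a * b * c)  ≡⟨ regroup ⟩
  ι f * (x * a * (y * b) * (z * c))
    ≡⟨ cong₂ (λ s t → ι f * (s * t)) (cong₂ _*_ (1/-inverse A) (1/-inverse B)) (1/-inverse C) ⟩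
  ι f * 1ℚ                         ≡⟨ ℚₚ.*-identityʳ (ι f) ⟩
  ι f                              ∎
  where
  open K₃N κ
  open ≡-Reasoning
  open +-*-Solver

  a b c x y z N : ℚ
  a = 1ℤ / A
  b = 1ℤ / B
  c = 1ℤ / C
  x = ι A
  y = ι B
  z = ι C
  N = ι H * (y * z + x * z + x * y) + z + y + x

  -- F with variables in place of factors 1, so that replacing these by xa = yb = zc = 1 makes every
  -- term a multiple of abc. With the reciprocals as indeterminates, the rest is a ring identity.
  Φ : ℚ → ℚ → ℚ → ℚ
  Φ s t u = ι H * (a * (t * u) + b * (s * u) + c * (s * t)) + a * b * u + a * c * t + b * c * s

  Φ-cong : ∀ {s t u s′ t′ u′} → s ≡ s′ → t ≡ t′ → u ≡ u′ → Φ s t u ≡ Φ s′ t′ u′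
  Φ-cong refl refl refl = refl

  F-expand : F ≡ Φ 1ℚ 1ℚ 1ℚ
  F-expand = trans
    (cong₂ _+_ (cong₂ _+_ (cong (_+_ (ι H * (a + b + c)))
      (1/-homo-* A B)) (1/-homo-* A C)) (1/-homo-* B C))
    (solve 4 (λ h a b c →
        h :* (a :+ b :+ c) :+ a :* b :+ a :* c :+ b :* c :=
        h :* (a :* con 1ℚ :+ b :* con 1ℚ :+ c :* con 1ℚ)
          :+ a :* b :* con 1ℚ :+ a :* c :* con 1ℚ :+ b :* c :* con 1ℚ)
      refl (ι H) a b c)

  clear-denominators : Φ (x * a) (y * b) (z * c) ≡ N * (a * b * c)
  clear-denominators = solve 7 (λ h x y z a b c →
      h :* (a :* (y :* b :* (z :* c)) :+ b :* (x :* a :* (z :* c)) :+ c :* (x :* a :* (y :* b)))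
        :+ a :* b :* (z :* c) :+ a :* c :* (y :* b) :+ b :* c :* (x :* a) :=
      (h :* (y :* z :+ x :* z :+ x :* y) :+ z :+ y :+ x) :* (a :* b :* c))
    refl (ι H) x y z a b c

  regroup : ι f * (x * y * z) * (a * b * c) ≡ ι f * (x * a * (y * b) * (z * c))
  regroup = solve 7 (λ f x y z a b c →
      f :* (x :* y :* z) :* (a :* b :* c) := f :* (x :* a :* (y :* b) :* (z :* c)))
    refl (ι f) x y z a b c

  N-eq : N ≡ ι f * (x * y * z)
  N-eq = begin
    N
      ≡⟨ cong (λ s → s + z + y + x) (cong (ι H *_)
           (cong₂ _+_ (cong₂ _+_ (ι-homo-* B C) (ι-homo-* A C)) (ι-homo-* A B))) ⟨
    ι H * (ι (B ℕ.* C) + ι (A ℕ.* C) + ι (A ℕ.* B)) + z + y + x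
      ≡⟨ cong (λ s → ι H * s + z + y + x)
           (trans (ι-homo-+ (B ℕ.* C ℕ.+ A ℕ.* C) (A ℕ.* B))
                  (cong (_+ ι (A ℕ.* B)) (ι-homo-+ (B ℕ.* C) (A ℕ.* C)))) ⟨
    ι H * ι S + z + y + x
      ≡⟨ cong (λ s → s + z + y + x) (ι-homo-* H S) ⟨
    ι (H ℕ.* S) + z + y + x
      ≡⟨ trans (ι-homo-+ (H ℕ.* S ℕ.+ C ℕ.+ B) A)
           (cong (_+ x) (trans (ι-homo-+ (H ℕ.* S ℕ.+ C) B)
             (cong (_+ y) (ι-homo-+ (H ℕ.* S) C)))) ⟨
    ι (H ℕ.* S ℕ.+ C ℕ.+ B ℕ.+ A)
      ≡⟨ cong ι eq ⟨
    ι (f ℕ.* (A ℕ.* B ℕ.* C))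
      ≡⟨ ι-homo-* f (A ℕ.* B ℕ.* C) ⟩
    ι f * ι (A ℕ.* B ℕ.* C)
      ≡⟨ cong (ι f *_) (trans (ι-homo-* (A ℕ.* B) C) (cong (_* z) (ι-homo-* A B))) ⟩
    ι f * (x * y * z)
      ∎
    where
    S : ℕ
    S = B ℕ.* C ℕ.+ A ℕ.* C ℕ.+ A ℕ.* B

G-integral : ∀ (κ : K₃N) → let open K₃N κ in ∀ f g →
  F ≡ ι f → f ℕ.* A ≡ g ℕ.+ H → G ≡ ι g
G-integral κ f g F≡f eq = begin
  ι A * F - ι H        ≡⟨ cong (λ x → ι A * x - ι H) F≡f ⟩
  ι A * ι f - ι H      ≡⟨ cong (_- ι H) (trans (ℚₚ.*-comm (ι A) (ι f)) (sym (ι-homo-* f A))) ⟩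
  ι (f ℕ.* A) - ι H      ≡⟨ cong (λ x → ι x - ι H) eq ⟩
  ι (g ℕ.+ H) - ι H      ≡⟨ cong (_- ι H) (ι-homo-+ g H) ⟩
  ι g + ι H - ι H      ≡⟨ solve 2 (λ x y → x :+ y :- y := x) refl (ι g) (ι H) ⟩
  ι g ∎
  where
  open K₃N κ
  open ≡-Reasoning
  open +-*-Solver

-- `T` is kept apart from `½ * ι d` because in the bounds on BC and ABC the factor ½ sits inside
-- `𝒞`.
half-bound : ∀ {P : Set} {m d T} → T ≡ ½ * ι d → 2 ℕ.* m ℕ.≤ d → (2 ℕ.* m ≡ d ⇔ P) →
             ι m ≤ T × (ι m ≡ T ⇔ P)
half-bound {m = m} {d} refl 2m≤d iff =
    subst (_≤ ½ * ι d) (½*ι[2*m] m) (ℚₚ.*-monoˡ-≤-nonNeg ½ (ι-mono-≤ 2m≤d))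
  , iff ⇔-∘ mk⇔ to from
  where
  to : ι m ≡ ½ * ι d → 2 ℕ.* m ≡ d
  to eq = ι-injective (begin
    ι (2 ℕ.* m)  ≡⟨ ι-homo-* 2 m ⟩
    ι 2 * ι m    ≡⟨ cong (ι 2 *_) eq ⟩
    ι 2 * (½ * ι d) ≡⟨ ℚₚ.*-assoc (ι 2) ½ (ι d) ⟨
    1ℚ * ι d ≡⟨ ℚₚ.*-identityˡ (ι d) ⟩
    ι d ∎)
    where open ≡-Reasoning
  from : 2 ℕ.* m ≡ d → ι m ≡ ½ * ι d
  from refl = sym (½*ι[2*m] m)

ι*½*ι : ∀ x y → ι x * (½ * ι y) ≡ ½ * ι (x ℕ.* y)
ι*½*ι x y = trans
  (solve 3 (λ x h y → x :* (h :* y) := h :* (x :* y)) refl (ι x) ½ (ι y))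
  (cong (½ *_) (sym (ι-homo-* x y)))
  where open +-*-Solver

-- Residues of H modulo 6.

odd⇒2∣pred : ∀ m → ¬ (2 ∣ m) → 2 ∣ m ∸ 1
odd⇒2∣pred zero                odd = 2 ∣0
odd⇒2∣pred (suc zero)          odd = 2 ∣0
odd⇒2∣pred (suc (suc zero))    odd = contradiction ∣-refl odd
odd⇒2∣pred (suc (suc (suc m))) odd =
  ∣m∣n⇒∣m+n ∣-refl (odd⇒2∣pred (suc m) (λ 2∣1+m → odd (∣m∣n⇒∣m+n ∣-refl 2∣1+m)))

-- For h ≡ 2 (mod 6) the prime 3 divides both h + 1 and 3 + h (h + 1), and for
-- h ≡ 4 (mod 6) it divides (h + 1) h + 1.
h%6≢2 : ∀ h → Coprime (h ℕ.+ 1) (3 ℕ.+ h ℕ.* (h ℕ.+ 1)) → h ℕ.% 6 ≢ 2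
h%6≢2 h coprime h%6≡2 = contradiction
  (coprime (3∣h+1 , ∣m∣n⇒∣m+n ∣-refl (∣n⇒∣m*n h 3∣h+1))) λ ()
  where
  shift : ∀ k → 2 ℕ.+ k ℕ.* 6 ℕ.+ 1 ≡ (1 ℕ.+ 2 ℕ.* k) ℕ.* 3
  shift k = ring (k ∷ [])

  3∣h+1 : 3 ∣ h ℕ.+ 1
  3∣h+1 = divides (1 ℕ.+ 2 ℕ.* (h ℕ./ 6)) (begin
    h ℕ.+ 1                          ≡⟨ cong (ℕ._+ 1) (m≡m%n+[m/n]*n h 6) ⟩
    h ℕ.% 6 ℕ.+ h ℕ./ 6 ℕ.* 6 ℕ.+ 1  ≡⟨ cong (λ x → x ℕ.+ h ℕ./ 6 ℕ.* 6 ℕ.+ 1) h%6≡2 ⟩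
    2 ℕ.+ h ℕ./ 6 ℕ.* 6 ℕ.+ 1        ≡⟨ shift (h ℕ./ 6) ⟩
    (1 ℕ.+ 2 ℕ.* (h ℕ./ 6)) ℕ.* 3    ∎)
    where open ≡-Reasoning

¬prime-*3 : ∀ {m} → 1 ℕ.< m → ¬ Prime (m ℕ.* 3)
¬prime-*3 {m} 1<m 3m-prime with prime⇒irreducible 3m-prime (n∣m*n m)
... | inj₁ ()
... | inj₂ 3≡m*3 = ℕₚ.<⇒≢ 1<m (ℕₚ.*-cancelʳ-≡ 1 m 3 3≡m*3)

h%6≢4 : ∀ h → Prime (suc ((h ℕ.+ 1) ℕ.* h)) → h ℕ.% 6 ≢ 4
h%6≢4 h p-prime h%6≡4 = ¬prime-*3 1<m (subst Prime p≡m*3 p-prime)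
  where
  k m : ℕ
  k = h ℕ./ 6
  -- For h = 4 + 6k, (h + 1) h + 1 = 36k² + 54k + 21 = 3m; the constant 7 ensures that this is not 3
  -- itself.
  m = 7 ℕ.+ (18 ℕ.* k ℕ.+ 12 ℕ.* k ℕ.* k)

  1<m : 1 ℕ.< m
  1<m = s≤s (s≤s z≤n)

  expand : ∀ k → suc ((4 ℕ.+ k ℕ.* 6 ℕ.+ 1) ℕ.* (4 ℕ.+ k ℕ.* 6)) ≡
                 (7 ℕ.+ (18 ℕ.* k ℕ.+ 12 ℕ.* k ℕ.* k)) ℕ.* 3
  expand k = ring (k ∷ [])

  h≡4+6k : h ≡ 4 ℕ.+ k ℕ.* 6
  h≡4+6k = trans (m≡m%n+[m/n]*n h 6) (cong (ℕ._+ k ℕ.* 6) h%6≡4)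

  p≡m*3 : suc ((h ℕ.+ 1) ℕ.* h) ≡ m ℕ.* 3
  p≡m*3 = trans (cong (λ x → suc ((x ℕ.+ 1) ℕ.* x)) h≡4+6k) (expand k)

even<6 : ∀ r → r ℕ.< 6 → 2 ∣ r → r ≢ 2 → r ≢ 4 → r ≡ 0
even<6 0 _ _   _   _   = refl
even<6 1 _ 2∣1 _   _   = contradiction 2∣1 (from-no (2 ∣? 1))
even<6 2 _ _   2≢2 _   = contradiction refl 2≢2
even<6 3 _ 2∣3 _   _   = contradiction 2∣3 (from-no (2 ∣? 3))
even<6 4 _ _   _   4≢4 = contradiction refl 4≢4
even<6 5 _ 2∣5 _   _   = contradiction 2∣5 (from-no (2 ∣? 5))
even<6 (suc (suc (suc (suc (suc (suc r)))))) (s≤s (s≤s (s≤s (s≤s (s≤s (s≤s ())))))) _ _ _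

h%6≡0 : ∀ h → 2 ∣ h → h ℕ.% 6 ≢ 2 → Prime (suc ((h ℕ.+ 1) ℕ.* h)) → h ℕ.% 6 ≡ 0
h%6≡0 h 2∣h h%6≢2 p-prime = even<6 (h ℕ.% 6) (m%n<n h 6)
  (%-presˡ-∣ 2∣h (divides 3 refl)) h%6≢2 (h%6≢4 h p-prime)

-- Application to a Korselt number with three factors.

suc-pred-exact : ∀ x a h → 1 ℕ.< x → a ℕ.* h ≡ x ∸ 1 → x ≡ suc (a ℕ.* h)
suc-pred-exact x a h 1<x ah≡ = trans (sym (ℕₚ.m+[n∸m]≡n (ℕₚ.<⇒≤ 1<x))) (cong suc (sym ah≡))

module Korselt (κ : K₃N) where
  open K₃N κ public

  p≡ : p ≡ suc (A ℕ.* H)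
  p≡ = suc-pred-exact p A H 1<p A-exact

  q≡ : q ≡ suc (B ℕ.* H)
  q≡ = suc-pred-exact q B H 1<q B-exact

  r≡ : r ≡ suc (C ℕ.* H)
  r≡ = suc-pred-exact r C H 1<r C-exact

  n≡ : n ≡ suc (A ℕ.* H) ℕ.* suc (B ℕ.* H) ℕ.* suc (C ℕ.* H)
  n≡ = cong₂ ℕ._*_ (cong₂ ℕ._*_ p≡ q≡) r≡

  A∣ : A ∣ B ℕ.* C ℕ.* H ℕ.+ B ℕ.+ C
  A∣ = factor∣ A B C H (subst₂ _∣_ (sym A-exact) (cong (_∸ 1) n≡) p-1∣n-1)

  B∣ : B ∣ A ℕ.* C ℕ.* H ℕ.+ A ℕ.+ C
  B∣ = factor∣ B A C H (subst₂ _∣_ (sym B-exact) (cong (_∸ 1) n≡′) q-1∣n-1)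
    where
    -- `factor∣` concerns the first factor of the product, so q is moved to the front.
    n≡′ : n ≡ suc (B ℕ.* H) ℕ.* suc (A ℕ.* H) ℕ.* suc (C ℕ.* H)
    n≡′ = trans n≡ (cong (ℕ._* suc (C ℕ.* H)) (ℕₚ.*-comm (suc (A ℕ.* H)) (suc (B ℕ.* H))))

  C∣ : C ∣ A ℕ.* B ℕ.* H ℕ.+ A ℕ.+ B
  C∣ = factor∣ C A B H (subst₂ _∣_ (sym C-exact) (cong (_∸ 1) n≡′) r-1∣n-1)
    where
    n≡′ : n ≡ suc (C ℕ.* H) ℕ.* suc (A ℕ.* H) ℕ.* suc (B ℕ.* H)
    n≡′ = trans n≡ (trans (ℕₚ.*-comm (suc (A ℕ.* H) ℕ.* suc (B ℕ.* H)) (suc (C ℕ.* H)))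
      (sym (ℕₚ.*-assoc (suc (C ℕ.* H)) (suc (A ℕ.* H)) (suc (B ℕ.* H)))))

  -- If d divides A, B and C, then dH divides p - 1, q - 1 and r - 1, hence their gcd H, so that d
  -- divides 1.
  ABC-coprime : TripleCoprime A B C
  ABC-coprime {d} d∣A d∣B d∣C = ∣1⇒≡1 (*-cancelʳ-∣ H
    (subst (d ℕ.* H ∣_) (sym (ℕₚ.*-identityˡ H))
      (gcd-greatest (scale A-exact d∣A) (gcd-greatest (scale B-exact d∣B) (scale C-exact d∣C)))))
    where
    scale : ∀ {x y} → x ℕ.* H ≡ y → d ∣ x → d ℕ.* H ∣ y
    scale refl d∣x = *-monoˡ-∣ H d∣x

  -- This is E (r - 1) = pq - 1 divided by H.
  EC : E ℕ.* C ≡ suc (H ℕ.* A) ℕ.* B ℕ.+ A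
  EC = ℕₚ.*-cancelʳ-≡ _ _ H (begin
    E ℕ.* C ℕ.* H                                ≡⟨ ℕₚ.*-assoc E C H ⟩
    E ℕ.* (C ℕ.* H)                              ≡⟨ cong (E ℕ.*_) C-exact ⟩
    E ℕ.* (r ∸ 1)                                ≡⟨ E-exact ⟩
    p ℕ.* q ∸ 1                                  ≡⟨ cong₂ (λ x y → x ℕ.* y ∸ 1) p≡ q≡ ⟩
    suc (A ℕ.* H) ℕ.* suc (B ℕ.* H) ∸ 1          ≡⟨ cong (_∸ 1) (expand A B H) ⟩
    (suc (H ℕ.* A) ℕ.* B ℕ.+ A) ℕ.* H            ∎)
    where
    open ≡-Reasoning
    expand : ∀ a b h → suc (a ℕ.* h) ℕ.* suc (b ℕ.* h) ≡
                       suc ((suc (h ℕ.* a) ℕ.* b ℕ.+ a) ℕ.* h)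
    expand a b h = ring (a ∷ b ∷ h ∷ [])

  cofactor-< : ∀ {a b x y} → a ℕ.* H ≡ x ∸ 1 → b ℕ.* H ≡ y ∸ 1 → 1 ℕ.< x → x ℕ.< y → a ℕ.< b
  cofactor-< {a} {b} {x} {y} ah≡ bh≡ 1<x x<y = ℕₚ.*-cancelʳ-< H a b
    (subst₂ ℕ._<_ (sym ah≡) (sym bh≡) (ℕₚ.∸-monoˡ-< x<y (ℕₚ.<⇒≤ 1<x)))

  open Quotients A B C H E ABC-coprime A∣ B∣ C∣ EC

  open Extremal A B C E f g H (ℕ.>-nonZero⁻¹ A)
    (cofactor-< A-exact B-exact 1<p p<q) (cofactor-< B-exact C-exact 1<q q<r) 2≤E
    (ℕ.>-nonZero⁻¹ H) fa gb EC

  F≡ : F ≡ ι f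
  F≡ = F-integral κ f fabc

  G≡ : G ≡ ι g
  G≡ = G-integral κ f g F≡ fa

  IsExtremal-ℚ : Set
  IsExtremal-ℚ = E ≡ 2 × F ≡ 1ℚ × G ≡ 1ℚ

  extremal⇔ : IsExtremal ⇔ IsExtremal-ℚ
  extremal⇔ = mk⇔
    (λ (E≡ , f≡ , g≡) → E≡ , trans F≡ (cong ι f≡) , trans G≡ (cong ι g≡))
    (λ (E≡ , F≡1 , G≡1) → E≡ , ι-injective (trans (sym F≡) F≡1) , ι-injective (trans (sym G≡) G≡1))

  rational-bound : ∀ m d {T} → T ≡ ½ * ι d → 2 ℕ.* m ℕ.≤ d × (2 ℕ.* m ≡ d ⇔ IsExtremal) →
                   ι m ≤ T × (ι m ≡ T ⇔ IsExtremal-ℚ)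
  rational-bound m d T≡ (2m≤d , iff) = half-bound {m = m} {d} T≡ 2m≤d (extremal⇔ ⇔-∘ iff)

  C-claim : ι C ≤ 𝒞 H × (ι C ≡ 𝒞 H ⇔ IsExtremal-ℚ)
  C-claim = rational-bound C (2𝒞 H) refl C-extremal

  BC-claim : ι (B ℕ.* C) ≤ ℬ H * 𝒞 H × (ι (B ℕ.* C) ≡ ℬ H * 𝒞 H ⇔ IsExtremal-ℚ)
  BC-claim = rational-bound (B ℕ.* C) (ℬₙ H ℕ.* 2𝒞 H) (ι*½*ι (ℬₙ H) (2𝒞 H)) BC-extremal

  ABC-claim : ι (A ℕ.* B ℕ.* C) ≤ 𝒜 H * ℬ H * 𝒞 H
            × (ι (A ℕ.* B ℕ.* C) ≡ 𝒜 H * ℬ H * 𝒞 H ⇔ IsExtremal-ℚ)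
  ABC-claim = rational-bound (A ℕ.* B ℕ.* C) ((H ℕ.+ 1) ℕ.* ℬₙ H ℕ.* 2𝒞 H)
    (trans (cong (_* 𝒞 H) (sym (ι-homo-* (H ℕ.+ 1) (ℬₙ H))))
      (ι*½*ι ((H ℕ.+ 1) ℕ.* ℬₙ H) (2𝒞 H))) ABC-extremal

  n-claim : ι n ≤ 𝒩 H × (ι n ≡ 𝒩 H ⇔ IsExtremal-ℚ)
  n-claim = rational-bound n (2𝒩 H) refl
    (subst (λ x → 2 ℕ.* x ℕ.≤ 2𝒩 H × (2 ℕ.* x ≡ 2𝒩 H ⇔ IsExtremal)) (sym n≡) n-extremal)

  -- Leaves only the residues 0, 2 and 4 modulo 6.
  2∣H : 2 ∣ H
  2∣H = gcd-greatest (odd⇒2∣pred p p-odd) (gcd-greatest (odd⇒2∣pred q q-odd) (odd⇒2∣pred r r-odd))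

  -- Coprimality of A and B excludes the residue 2 for every `K₃N`; primality of p excludes 4.
  extremal-mod-6 : IsExtremal-ℚ → H ℕ.% 6 ≢ 2 × (IsC₃N κ → H ℕ.% 6 ≡ 0)
  extremal-mod-6 extremal-ℚ = H%6≢2 , λ (p-prime , _) →
    h%6≡0 H 2∣H H%6≢2 (subst Prime (trans p≡ (cong (λ x → suc (x ℕ.* H)) A≡)) p-prime)
    where
    extremal : IsExtremal
    extremal = Equivalence.from extremal⇔ extremal-ℚ

    A≡ : A ≡ H ℕ.+ 1
    A≡ = extremal⇒A extremal

    H%6≢2 : H ℕ.% 6 ≢ 2
    H%6≢2 = h%6≢2 H (subst₂ Coprime A≡
      (trans (extremal⇒B extremal) (cong (λ x → 3 ℕ.+ H ℕ.* x) A≡)) a⊥b)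

theorem4p9 : (κ : K₃N) → let open K₃N κ in
    (ι C ≤ 𝒞 H
    × (ι C ≡ 𝒞 H ⇔ (E ≡ 2 × F ≡ 1ℚ × G ≡ 1ℚ)))
    × (ι (B ℕ.* C) ≤ ℬ H * 𝒞 H
    × (ι (B ℕ.* C) ≡ ℬ H * 𝒞 H ⇔ (E ≡ 2 × F ≡ 1ℚ × G ≡ 1ℚ)))
    × (ι (A ℕ.* B ℕ.* C) ≤ 𝒜 H * ℬ H * 𝒞 H
    × (ι (A ℕ.* B ℕ.* C) ≡ 𝒜 H * ℬ H * 𝒞 H ⇔ (E ≡ 2 × F ≡ 1ℚ × G ≡ 1ℚ)))
    × (ι n ≤ 𝒩 H
    × (ι n ≡ 𝒩 H ⇔ (E ≡ 2 × F ≡ 1ℚ × G ≡ 1ℚ)))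
    × ((ι C ≡ 𝒞 H
    ⊎ ι (B ℕ.* C) ≡ ℬ H * 𝒞 H
    ⊎ ι (A ℕ.* B ℕ.* C) ≡ 𝒜 H * ℬ H * 𝒞 H
    ⊎ ι n ≡ 𝒩 H) →
    H ℕ.% 6 ≢ 2 × (IsC₃N κ → H ℕ.% 6 ≡ 0))
theorem4p9 κ = C-claim , BC-claim , ABC-claim , n-claim , λ equality →
  -- Each of the four equalities implies E = 2 and F = G = 1 through its own claim.
  extremal-mod-6 ([ to C-claim , [ to BC-claim , [ to ABC-claim , to n-claim ] ] ] equality)
  where
  open Korselt κ
  to : ∀ {P Q R : Set} → P × (Q ⇔ R) → Q → R
  to (_ , iff) = Equivalence.to iff
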